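{- Let $y,q$ be indeterminates. For every $n\ge 0$, \[ [z^n]\left(\cfrac{1}{1-\cfrac{\lambda_1 z}{1-\cfrac{\lambda_2 z}{1-\cfrac{\lambda_3 z}{1-\cdots}}}}\right) =\frac{1}{(1-q)^{2n}}\sum_{k=0}^{n}\left(\binom{2n}{n-k}-\binom{2n}{n-k-1}\right)q^{k(k+1)}\sum_{i=-k}^{k}y^{i}q^{ -i^2}, \] where for $m\ge 1$ odd, $\lambda_m=\dfrac{(1+yq^m)(1+y^{ -1}q^m)}{(1-q)^2}$, and for $m\ge 2$ even, $\lambda_m=\left(\dfrac{1-q^m}{1-q}\right)^2$.
   Context: The infinite continued fraction is understood as a formal power series in $z$ (its coefficients are limits of those of its finite truncations). $[z^n]F$ denotes the coefficient of $z^n$ in the power series $F$. Binomial coefficients $\binom{a}{b}$ with $b<0$ are $0$. -}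

module Defs where

open import Level using (Level)
open import Algebra.Bundles using (CommutativeRing)
open import Data.Bool using (Bool; true; false; not; if_then_else_)
open import Data.Nat as ℕ using (ℕ; zero; suc; _∸_)
open import Data.Nat.Combinatorics using (_C_)
open import Data.Integer as ℤ using (ℤ; +_; -[1+_])

odd : ℕ → Bool
odd zero = false
odd (suc m) = not (odd m)

binZ : ℕ → ℤ → ℕ
binZ a (+ b) = a C b
binZ a -[1+ b ] = 0

module CF {c ℓ : Level} (R : CommutativeRing c ℓ) where
  open CommutativeRing R

  pow : Carrier → ℕ → Carrier
  pow x zero = 1#
  pow x (suc n) = x * pow x n

  -- integer powers of an element x with given inverse x'
  zpow : Carrier → Carrier → ℤ → Carrier
  zpow x x' (+ n) = pow x n
  zpow x x' -[1+ n ] = pow x' (suc n)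

  fromℕ : ℕ → Carrier
  fromℕ zero = 0#
  fromℕ (suc n) = 1# + fromℕ n

  sumUpTo : ℕ → (ℕ → Carrier) → Carrier
  sumUpTo zero f = f 0
  sumUpTo (suc n) f = sumUpTo n f + f (suc n)

  -- formal power series in z, given by their coefficient sequence
  Series : Set c
  Series = ℕ → Carrier

  one : Series
  one zero = 1#
  one (suc _) = 0#

  _⊛_ : Series → Series → Series
  (f ⊛ g) n = sumUpTo n (λ k → f k * g (n ∸ k))

  spow : Series → ℕ → Series
  spow f zero = one
  spow f (suc j) = f ⊛ spow f j

  scale : Carrier → Series → Series
  scale a f n = a * f n

  -- 1 / (1 - z G) = Σ_j z^j G^j ;  [z^n] = Σ_{j=0}^{n} [z^(n-j)] G^j
  geomZ : Series → Series
  geomZ G n = sumUpTo n (λ j → spow G j (n ∸ j))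

  -- finite truncation of depth d of the continued fraction
  --   1/(1 - λ_m z/(1 - λ_(m+1) z/(1 - ...)))   (depth 0 gives 1)
  cf : (ℕ → Carrier) → ℕ → ℕ → Series
  cf lam zero m = one
  cf lam (suc d) m = geomZ (scale (lam m) (cf lam d (suc m)))

  -- λ_m, with y' = y⁻¹ and w = (1-q)⁻¹
  lamCF : (y y' q w : Carrier) → ℕ → Carrier
  lamCF y y' q w m =
    if odd m
    then ((1# + y * pow q m) * (1# + y' * pow q m)) * (w * w)
    else ((1# - pow q m) * w) * ((1# - pow q m) * w)

  -- right-hand side, with y' = y⁻¹, q' = q⁻¹, w = (1-q)⁻¹
  rhs : (y y' q q' w : Carrier) → ℕ → Carrier
  rhs y y' q q' w n =
    pow w (2 ℕ.* n) *
    sumUpTo n (λ k →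
      ((fromℕ (binZ (2 ℕ.* n) (+ n ℤ.- + k))
         - fromℕ (binZ (2 ℕ.* n) ((+ n ℤ.- + k) ℤ.- + 1)))
       * pow q (k ℕ.* (k ℕ.+ 1)))
      * sumUpTo (2 ℕ.* k) (λ j →
          zpow y y' (+ j ℤ.- + k)
          * zpow q q' (ℤ.- ((+ j ℤ.- + k) ℤ.* (+ j ℤ.- + k)))))

{-# OPTIONS --safe #-}

-- Put p = q² and scale out (1 - q)⁻², so that λ_{2j} = (1 - p^j)² and λ_{2j+1} = ϑ(p^j) with
-- ϑ(X) = (1 + y q X)(1 + y⁻¹ q X).  With t = (1 + v)(1 + v⁻¹), the right-hand side is L(tⁿ) for the
-- functional L on symmetric Laurent polynomials in v that sends Σ_{|i| ≤ k} vⁱ to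
-- q^{k(k+1)} Σ_{|i| ≤ k} yⁱ q^{-i²}: the ballot numbers expand tⁿ in these sums.
--
-- L multiplies nicely on the basis ψ_j = Π_{i<j} (1 + pⁱ v)(1 + pⁱ v⁻¹), namely
-- L(ψ_{j+1}) = ϑ(p^j) L(ψ_j).  This follows from the q-difference equation of the partial theta
-- sequence b below, L being f ↦ L_b((1 - v⁻¹) f) for the functional L_b sending v^k to b(k).
--
-- The orthogonal polynomials of the continued fraction (continuous dual q-Hahn polynomials) are
-- p-differences of the ψ_j.  Hence they satisfy the three-term recurrence with coefficients
-- λ_{2h} + λ_{2h+1} and λ_{2h-1} λ_{2h}, and L annihilates all of them but the constant one.
-- So the moments L(tⁿ) are the coefficients of the continued fraction.
module Submission where

open import Defs
open import Level using (Level)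
open import Algebra.Bundles using (CommutativeRing)
open import Data.Nat using (ℕ; _≤_)
open import Data.Product using (∃)
open import Algebra.Solver.Ring.AlmostCommutativeRing using (fromCommutativeRing; _-Raw-AlmostCommutative⟶_)
open import Data.Bool using (true; false)
open import Data.Integer as ℤ using (ℤ; +_; -[1+_]; _⊖_)
open import Data.Maybe using (Maybe; just; nothing)
open import Data.Nat as ℕ using (zero; suc; _∸_; _<_; z≤n; s≤s)
open import Data.Nat.Combinatorics using (_C_; nCk≡nC[n∸k]; nCk+nC[k+1]≡[n+1]C[k+1])
open import Data.Nat.Solver using (module +-*-Solver)
open import Data.Product using (_,_)
open import Function using (_∘_)
open import Relation.Binary.PropositionalEquality as ≡ using (_≡_)
open import Relation.Nullary using (yes; no)
import Algebra.Properties.Ring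
import Algebra.Properties.Semiring.Mult.TCOptimised
import Algebra.Solver.Ring
import Data.Integer.Properties as ℤ
import Data.Nat.Properties as ℕ
import Relation.Binary.Reasoning.Setoid

-- Ring solver with integer coefficients over any commutative ring.

module IntegerSolver {c ℓ : Level} (R : CommutativeRing c ℓ) where
  open CommutativeRing R hiding (zero)
  open Algebra.Properties.Ring ring
  open Algebra.Properties.Semiring.Mult.TCOptimised semiring
  open Relation.Binary.Reasoning.Setoid setoid

  -- With this variant of `×` the constants + 1 and + 2 denote `1#` and `1# + 1#` by definition, so
  -- solved equations match goals literally.
  fromℤ : ℤ → Carrier
  fromℤ (+ n) = n × 1#
  fromℤ -[1+ n ] = - (suc n × 1#)

  cancel-diff : ∀ x a b → (x + a) - (x + b) ≈ a - b
  cancel-diff x a b = begin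
    (x + a) - (x + b)       ≈⟨ +-cong (+-comm x a) (sym (-‿+-comm x b)) ⟩
    (a + x) + (- x + - b)   ≈⟨ +-assoc a x _ ⟩
    a + (x + (- x + - b))   ≈⟨ +-congˡ (sym (+-assoc x (- x) (- b))) ⟩
    a + (x + - x + - b)     ≈⟨ +-congˡ (+-congʳ (-‿inverseʳ x)) ⟩
    a + (0# + - b)          ≈⟨ +-congˡ (+-identityˡ (- b)) ⟩
    a - b                   ∎

  fromℤ-⊖ : ∀ m n → fromℤ (m ⊖ n) ≈ m × 1# - n × 1#
  fromℤ-⊖ zero zero = sym (-‿inverseʳ 0#)
  fromℤ-⊖ zero (suc n) = sym (+-identityˡ _)
  fromℤ-⊖ (suc m) zero = sym (trans (+-congˡ -0#≈0#) (+-identityʳ _))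
  fromℤ-⊖ (suc m) (suc n) = begin
    fromℤ (suc m ⊖ suc n)            ≡⟨ ≡.cong fromℤ (ℤ.[1+m]⊖[1+n]≡m⊖n m n) ⟩
    fromℤ (m ⊖ n)                    ≈⟨ fromℤ-⊖ m n ⟩
    m × 1# - n × 1#                  ≈⟨ cancel-diff 1# _ _ ⟨
    (1# + m × 1#) - (1# + n × 1#)    ≈⟨ +-cong (1+× m 1#) (-‿cong (1+× n 1#)) ⟨
    suc m × 1# - suc n × 1#          ∎

  fromℤ-neg : ∀ i → fromℤ (ℤ.- i) ≈ - fromℤ i
  fromℤ-neg (+ zero) = sym -0#≈0#
  fromℤ-neg (+ suc n) = refl
  fromℤ-neg -[1+ n ] = sym (-‿involutive _)

  fromℤ-+ : ∀ i j → fromℤ (i ℤ.+ j) ≈ fromℤ i + fromℤ j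
  fromℤ-+ (+ m) (+ n) = ×-homo-+ 1# m n
  fromℤ-+ (+ m) -[1+ n ] = fromℤ-⊖ m (suc n)
  fromℤ-+ -[1+ m ] (+ n) = trans (fromℤ-⊖ n (suc m)) (+-comm _ _)
  fromℤ-+ -[1+ m ] -[1+ n ] = begin
    - (suc (suc (m ℕ.+ n)) × 1#)          ≡⟨ ≡.cong (λ k → - (suc k × 1#)) (ℕ.+-suc m n) ⟨
    - ((suc m ℕ.+ suc n) × 1#)            ≈⟨ -‿cong (×-homo-+ 1# (suc m) (suc n)) ⟩
    - (suc m × 1# + suc n × 1#)           ≈⟨ -‿+-comm _ _ ⟨
    - (suc m × 1#) + - (suc n × 1#)       ∎

  fromℤ-pos* : ∀ m j → fromℤ (+ m ℤ.* j) ≈ m × 1# * fromℤ j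
  fromℤ-pos* m (+ n) = begin
    fromℤ (+ m ℤ.* + n)   ≡⟨ ≡.cong fromℤ (ℤ.pos-* m n) ⟨
    (m ℕ.* n) × 1#        ≈⟨ ×1-homo-* m n ⟩
    m × 1# * n × 1#       ∎
  fromℤ-pos* m -[1+ n ] = begin
    fromℤ (+ m ℤ.* ℤ.- (+ suc n))   ≡⟨ ≡.cong fromℤ (ℤ.neg-distribʳ-* (+ m) (+ suc n)) ⟨
    fromℤ (ℤ.- (+ m ℤ.* + suc n))   ≈⟨ fromℤ-neg (+ m ℤ.* + suc n) ⟩
    - fromℤ (+ m ℤ.* + suc n)       ≈⟨ -‿cong (fromℤ-pos* m (+ suc n)) ⟩
    - (m × 1# * suc n × 1#)         ≈⟨ -‿distribʳ-* _ _ ⟩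
    m × 1# * - (suc n × 1#)         ∎

  fromℤ-* : ∀ i j → fromℤ (i ℤ.* j) ≈ fromℤ i * fromℤ j
  fromℤ-* (+ m) j = fromℤ-pos* m j
  fromℤ-* -[1+ m ] j = begin
    fromℤ (ℤ.- (+ suc m) ℤ.* j)   ≡⟨ ≡.cong fromℤ (ℤ.neg-distribˡ-* (+ suc m) j) ⟨
    fromℤ (ℤ.- (+ suc m ℤ.* j))   ≈⟨ fromℤ-neg (+ suc m ℤ.* j) ⟩
    - fromℤ (+ suc m ℤ.* j)       ≈⟨ -‿cong (fromℤ-pos* (suc m) j) ⟩
    - (suc m × 1# * fromℤ j)      ≈⟨ -‿distribˡ-* _ _ ⟩
    - (suc m × 1#) * fromℤ j      ∎

  morphism : ℤ.+-*-rawRing -Raw-AlmostCommutative⟶ fromCommutativeRing R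
  morphism = record
    { ⟦_⟧ = fromℤ
    ; +-homo = fromℤ-+
    ; *-homo = fromℤ-*
    ; -‿homo = fromℤ-neg
    ; 0-homo = refl
    ; 1-homo = refl
    }

  -- Distinct integers may coincide in the ring, so inequality gives no verdict.
  fromℤ-≟ : ∀ i j → Maybe (fromℤ i ≈ fromℤ j)
  fromℤ-≟ i j with i ℤ.≟ j
  ... | yes i≡j = just (reflexive (≡.cong fromℤ i≡j))
  ... | no _ = nothing

  open Algebra.Solver.Ring ℤ.+-*-rawRing (fromCommutativeRing R) morphism fromℤ-≟ public

-- Power series and continued fractions.

module Series {c ℓ : Level} (R : CommutativeRing c ℓ) where
  open CommutativeRing R hiding (zero)
  open CF R
  open IntegerSolver R
  open Relation.Binary.Reasoning.Setoid setoid

  sum-cong : ∀ n {f g : ℕ → Carrier} → (∀ k → k ≤ n → f k ≈ g k) → sumUpTo n f ≈ sumUpTo n g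
  sum-cong zero f≈g = f≈g 0 z≤n
  sum-cong (suc n) f≈g =
    +-cong (sum-cong n (λ k k≤n → f≈g k (ℕ.m≤n⇒m≤1+n k≤n))) (f≈g (suc n) ℕ.≤-refl)

  sum-+ : ∀ n (f g : ℕ → Carrier) → sumUpTo n (λ k → f k + g k) ≈ sumUpTo n f + sumUpTo n g
  sum-+ zero f g = refl
  sum-+ (suc n) f g = trans (+-congʳ (sum-+ n f g))
    (solve 4 (λ a b x y → (a :+ b) :+ (x :+ y) := (a :+ x) :+ (b :+ y)) refl _ _ _ _)

  sum-*ˡ : ∀ n a (f : ℕ → Carrier) → sumUpTo n (λ k → a * f k) ≈ a * sumUpTo n f
  sum-*ˡ zero a f = refl
  sum-*ˡ (suc n) a f = trans (+-congʳ (sum-*ˡ n a f)) (sym (distribˡ a _ _))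

  sum-head : ∀ n (f : ℕ → Carrier) → sumUpTo (suc n) f ≈ f 0 + sumUpTo n (f ∘ suc)
  sum-head zero f = refl
  sum-head (suc n) f = trans (+-congʳ (sum-head n f)) (+-assoc _ _ _)

  ⊛-suc : ∀ (f g : Series) n → (f ⊛ g) (suc n) ≈ f 0 * g (suc n) + ((f ∘ suc) ⊛ g) n
  ⊛-suc f g n = sum-head n (λ k → f k * g (suc n ∸ k))

  ⊛-congˡ : ∀ n (f : Series) {g g′ : Series} → (∀ k → k ≤ n → g k ≈ g′ k) → (f ⊛ g) n ≈ (f ⊛ g′) n
  ⊛-congˡ n f g≈g′ = sum-cong n λ k _ → *-congˡ (g≈g′ (n ∸ k) (ℕ.m∸n≤m n k))

  ⊛-congʳ : ∀ n (g : Series) {f f′ : Series} → (∀ k → f k ≈ f′ k) → (f ⊛ g) n ≈ (f′ ⊛ g) n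
  ⊛-congʳ n g f≈f′ = sum-cong n λ k _ → *-congʳ (f≈f′ k)

  ⊛-distribʳ-+ : ∀ n (f g h : Series) → ((λ k → f k + g k) ⊛ h) n ≈ (f ⊛ h) n + (g ⊛ h) n
  ⊛-distribʳ-+ n f g h = trans (sum-cong n (λ k _ → distribʳ _ _ _)) (sum-+ n _ _)

  ⊛-scale : ∀ n a (f g : Series) → (scale a f ⊛ g) n ≈ a * (f ⊛ g) n
  ⊛-scale n a f g = trans (sum-cong n (λ k _ → *-assoc _ _ _)) (sum-*ˡ n a _)

  -- Induction on the degree, for all f: splitting f into constant term and shift leaves a product
  -- with the shift of f, one degree lower.
  ⊛-assoc : ∀ n (f g h : Series) → ((f ⊛ g) ⊛ h) n ≈ (f ⊛ (g ⊛ h)) n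
  ⊛-assoc zero f g h = *-assoc _ _ _
  ⊛-assoc (suc n) f g h = begin
    ((f ⊛ g) ⊛ h) (suc n)
      ≈⟨ ⊛-suc (f ⊛ g) h n ⟩
    f 0 * g 0 * h (suc n) + (((f ⊛ g) ∘ suc) ⊛ h) n
      ≈⟨ +-congˡ (⊛-congʳ n h (⊛-suc f g)) ⟩
    f 0 * g 0 * h (suc n) + ((λ k → scale (f 0) (g ∘ suc) k + ((f ∘ suc) ⊛ g) k) ⊛ h) n
      ≈⟨ +-congˡ (⊛-distribʳ-+ n (scale (f 0) (g ∘ suc)) ((f ∘ suc) ⊛ g) h) ⟩
    f 0 * g 0 * h (suc n) + ((scale (f 0) (g ∘ suc) ⊛ h) n + (((f ∘ suc) ⊛ g) ⊛ h) n)
      ≈⟨ +-congˡ (+-cong (⊛-scale n (f 0) (g ∘ suc) h) (⊛-assoc n (f ∘ suc) g h)) ⟩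
    f 0 * g 0 * h (suc n) + (f 0 * ((g ∘ suc) ⊛ h) n + ((f ∘ suc) ⊛ (g ⊛ h)) n)
      ≈⟨ solve 5 (λ a b x y z → a :* b :* x :+ (a :* y :+ z) := a :* (b :* x :+ y) :+ z) refl _ _ _ _ _ ⟩
    f 0 * (g 0 * h (suc n) + ((g ∘ suc) ⊛ h) n) + ((f ∘ suc) ⊛ (g ⊛ h)) n
      ≈⟨ +-congʳ (*-congˡ (⊛-suc g h n)) ⟨
    f 0 * (g ⊛ h) (suc n) + ((f ∘ suc) ⊛ (g ⊛ h)) n
      ≈⟨ ⊛-suc f (g ⊛ h) n ⟨
    (f ⊛ (g ⊛ h)) (suc n) ∎

  ⊛-identityʳ : ∀ n (f : Series) → (f ⊛ one) n ≈ f n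
  ⊛-identityʳ zero f = *-identityʳ _
  ⊛-identityʳ (suc n) f = begin
    (f ⊛ one) (suc n)                    ≈⟨ ⊛-suc f one n ⟩
    f 0 * 0# + ((f ∘ suc) ⊛ one) n       ≈⟨ +-cong (zeroʳ _) (⊛-identityʳ n (f ∘ suc)) ⟩
    0# + f (suc n)                       ≈⟨ +-identityˡ _ ⟩
    f (suc n)                            ∎

  -- The series Σ_j z^j s_j; `geomZ G` is the case s_j = G^j.
  diagonal : (ℕ → Series) → Series
  diagonal s n = sumUpTo n (λ j → s j (n ∸ j))

  ⊛-diagonal : ∀ n (f : Series) (s : ℕ → Series) → diagonal (λ j → f ⊛ s j) n ≈ (f ⊛ diagonal s) n
  ⊛-diagonal zero f s = refl
  ⊛-diagonal (suc n) f s = begin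
    sumUpTo n (λ j → (f ⊛ s j) (suc n ∸ j)) + (f ⊛ s (suc n)) (n ∸ n)
      -- The summand j = n + 1 is taken in degree 0, where `step` does not apply; it contributes
      -- only to the part with factor `f 0`.
      ≈⟨ +-cong (sum-cong n step) (reflexive (≡.cong (f ⊛ s (suc n)) (ℕ.n∸n≡0 n))) ⟩
    sumUpTo n (λ j → f 0 * s j (suc n ∸ j) + ((f ∘ suc) ⊛ s j) (n ∸ j)) + f 0 * s (suc n) 0
      ≈⟨ +-cong (trans (sum-+ n _ _) (+-congʳ (sum-*ˡ n (f 0) _)))
                (*-congˡ (reflexive (≡.cong (s (suc n)) (≡.sym (ℕ.n∸n≡0 n))))) ⟩
    f 0 * sumUpTo n (λ j → s j (suc n ∸ j)) + diagonal (λ j → (f ∘ suc) ⊛ s j) n + f 0 * s (suc n) (n ∸ n)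
      ≈⟨ solve 4 (λ a x y z → a :* x :+ y :+ a :* z := a :* (x :+ z) :+ y) refl _ _ _ _ ⟩
    f 0 * diagonal s (suc n) + diagonal (λ j → (f ∘ suc) ⊛ s j) n
      ≈⟨ +-congˡ (⊛-diagonal n (f ∘ suc) s) ⟩
    f 0 * diagonal s (suc n) + ((f ∘ suc) ⊛ diagonal s) n
      ≈⟨ ⊛-suc f (diagonal s) n ⟨
    (f ⊛ diagonal s) (suc n) ∎
    where
    step : ∀ j → j ≤ n → (f ⊛ s j) (suc n ∸ j) ≈ f 0 * s j (suc n ∸ j) + ((f ∘ suc) ⊛ s j) (n ∸ j)
    step j j≤n rewrite ℕ.+-∸-assoc 1 j≤n = ⊛-suc f (s j) (n ∸ j)

  geomZ-suc : ∀ (G : Series) n → geomZ G (suc n) ≈ (G ⊛ geomZ G) n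
  geomZ-suc G n = begin
    geomZ G (suc n)                               ≈⟨ sum-head n (λ j → spow G j (suc n ∸ j)) ⟩
    0# + diagonal (λ j → G ⊛ spow G j) n          ≈⟨ +-identityˡ _ ⟩
    diagonal (λ j → G ⊛ spow G j) n               ≈⟨ ⊛-diagonal n G (spow G) ⟩
    (G ⊛ geomZ G) n                               ∎

  geomZ-⊛-suc : ∀ (G U : Series) n → (geomZ G ⊛ U) (suc n) ≈ U (suc n) + (G ⊛ (geomZ G ⊛ U)) n
  geomZ-⊛-suc G U n = begin
    (geomZ G ⊛ U) (suc n)                              ≈⟨ ⊛-suc (geomZ G) U n ⟩
    1# * U (suc n) + ((geomZ G ∘ suc) ⊛ U) n           ≈⟨ +-cong (*-identityˡ _) (⊛-congʳ n U (geomZ-suc G)) ⟩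
    U (suc n) + ((G ⊛ geomZ G) ⊛ U) n                  ≈⟨ +-congˡ (⊛-assoc n G (geomZ G) U) ⟩
    U (suc n) + (G ⊛ (geomZ G ⊛ U)) n                  ∎

  -- The factor z in T = U + z G T makes every coefficient of T depend on earlier ones only. The
  -- bound d allows equations known only up to a finite degree.
  geomZ-unique : ∀ (G T U : Series) d → T 0 ≈ U 0 →
    (∀ n → n < d → T (suc n) ≈ U (suc n) + (G ⊛ T) n) →
    ∀ n → n ≤ d → T n ≈ (geomZ G ⊛ U) n
  geomZ-unique G T U d T₀ Tₛ n n≤d = below n n≤d n ℕ.≤-refl
    where
    below : ∀ n → n ≤ d → ∀ k → k ≤ n → T k ≈ (geomZ G ⊛ U) k
    below n n≤d zero _ = trans T₀ (sym (*-identityˡ _))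
    below (suc n) n<d (suc k) (s≤s k≤n) = begin
      T (suc k)                               ≈⟨ Tₛ k (ℕ.≤-<-trans k≤n n<d) ⟩
      U (suc k) + (G ⊛ T) k                   ≈⟨ +-congˡ (⊛-congˡ k G λ i i≤k →
                                                   below n (ℕ.<⇒≤ n<d) i (ℕ.≤-trans i≤k k≤n)) ⟩
      U (suc k) + (G ⊛ (geomZ G ⊛ U)) k       ≈⟨ geomZ-⊛-suc G U k ⟨
      (geomZ G ⊛ U) (suc k)                   ∎

  -- If F_m denotes the continued fraction starting with λ_m, then tower lam m is F_1 ⋯ F_m.
  tower : (ℕ → Carrier) → ℕ → Series
  tower lam zero n = one n
  tower lam (suc m) zero = 1#
  tower lam (suc m) (suc n) = tower lam m (suc n) + lam (suc m) * tower lam (suc (suc m)) n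

  tower-0 : ∀ lam m → tower lam m 0 ≈ 1#
  tower-0 lam zero = refl
  tower-0 lam (suc m) = refl

  -- Induction on the depth. The recursion of `tower` multiplies F_{m+1} = 1 + λ_{m+1} z F_{m+1}
  -- F_{m+2} by F_1 ⋯ F_m; replacing F_{m+2} by its truncation gives an equation for `geomZ-unique`.
  -- The factor z gains one correct degree per level.
  tower-cf : ∀ lam d m n → n ≤ d → tower lam (suc m) n ≈ (cf lam d (suc m) ⊛ tower lam m) n
  tower-cf lam zero m zero z≤n = sym (trans (*-identityˡ _) (tower-0 lam m))
  tower-cf lam (suc d) m n n≤d =
    geomZ-unique (scale (lam (suc m)) (cf lam d (suc (suc m)))) (tower lam (suc m)) (tower lam m) (suc d)
      (sym (tower-0 lam m))
      (λ { k (s≤s k≤d) → +-congˡ (trans (*-congˡ (tower-cf lam d (suc m) k k≤d))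
                                        (sym (⊛-scale k (lam (suc m)) _ (tower lam (suc m))))) })
      n n≤d

  cf≈tower : ∀ lam d n → n ≤ d → cf lam d 1 n ≈ tower lam 1 n
  cf≈tower lam d n n≤d = begin
    cf lam d 1 n                        ≈⟨ ⊛-identityʳ n (cf lam d 1) ⟨
    (cf lam d 1 ⊛ one) n                ≈⟨ tower-cf lam d 0 n n≤d ⟨
    tower lam 1 n                       ∎

  tower-cong : ∀ lam lam′ → (∀ m → lam (suc m) ≈ lam′ (suc m)) → ∀ m n → tower lam m n ≈ tower lam′ m n
  tower-cong lam lam′ eq zero n = refl
  tower-cong lam lam′ eq (suc m) zero = refl
  tower-cong lam lam′ eq (suc m) (suc n) =
    +-cong (tower-cong lam lam′ eq m (suc n)) (*-cong (eq m) (tower-cong lam lam′ eq (suc (suc m)) n))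

  -- Each λ comes with one z, so scaling all λ by v substitutes v z for z.
  tower-homogeneous : ∀ lam v m n → tower (λ i → lam i * v) m n ≈ pow v n * tower lam m n
  tower-homogeneous lam v zero zero = sym (*-identityˡ _)
  tower-homogeneous lam v zero (suc n) = sym (zeroʳ _)
  tower-homogeneous lam v (suc m) zero = sym (*-identityˡ _)
  tower-homogeneous lam v (suc m) (suc n) = begin
    tower (λ i → lam i * v) m (suc n) + lam (suc m) * v * tower (λ i → lam i * v) (suc (suc m)) n
      ≈⟨ +-cong (tower-homogeneous lam v m (suc n)) (*-congˡ (tower-homogeneous lam v (suc (suc m)) n)) ⟩
    pow v (suc n) * tower lam m (suc n) + lam (suc m) * v * (pow v n * tower lam (suc (suc m)) n)
      ≈⟨ solve 5 (λ v w a l b → (v :* w) :* a :+ l :* v :* (w :* b) := (v :* w) :* (a :+ l :* b)) refl _ _ _ _ _ ⟩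
    pow v (suc n) * tower lam (suc m) (suc n) ∎

  -- Even contraction of the continued fraction.

  -- Recursive doubling, so that `twice (suc h)` unfolds to two successors and `prefix` and `odd`
  -- compute on it.
  twice : ℕ → ℕ
  twice zero = zero
  twice (suc h) = suc (suc (twice h))

  delay : ℕ → Series → Series
  delay zero f n = f n
  delay (suc h) f zero = 0#
  delay (suc h) f (suc n) = delay h f n

  -- The recursion of `tower` multiplied by z^h; it holds in degree 0 as well.
  delay-tower : ∀ lam h m n →
    delay h (tower lam (suc m)) n ≈ delay h (tower lam m) n + lam (suc m) * delay (suc h) (tower lam (suc (suc m))) n
  delay-tower lam zero m zero = sym (trans (+-cong (tower-0 lam m) (zeroʳ _)) (+-identityʳ _))
  delay-tower lam zero m (suc n) = refl
  delay-tower lam (suc h) m zero = sym (trans (+-congˡ (zeroʳ _)) (+-identityʳ _))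
  delay-tower lam (suc h) m (suc n) = delay-tower lam h m n

  prefix : (ℕ → Carrier) → ℕ → Carrier
  prefix lam zero = 1#
  prefix lam (suc m) = lam (suc m) * prefix lam m

  -- Π h n abstracts L(tⁿ P_h) for monic orthogonal polynomials P_h: the conditions at n = 0 are
  -- orthogonality to 1, the others the three-term recurrence for t P_h.
  module _ (lam : ℕ → Carrier) (Π : ℕ → ℕ → Carrier)
    (Π-00 : Π 0 0 ≈ 1#) (Π-s0 : ∀ h → Π (suc h) 0 ≈ 0#)
    (Π-0s : ∀ n → Π 0 (suc n) ≈ Π 1 n + lam 1 * Π 0 n)
    (Π-ss : ∀ h n → Π (suc h) (suc n) ≈
       Π (suc (suc h)) n
       + (lam (twice (suc h)) + lam (suc (twice (suc h)))) * Π (suc h) n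
       + lam (suc (twice h)) * lam (twice (suc h)) * Π h n)
    where

    -- Induction on n, jointly with `oddForm`. The recurrence factors through the combinations Π (h
    -- + 1) + λ_{2h+1} Π h, which belong to the odd indices of `tower`; each half is then one use of
    -- `delay-tower`.
    closedForm : ∀ n h → Π h n ≈ prefix lam (twice h) * delay h (tower lam (suc (twice h))) n
    oddForm : ∀ n h → Π (suc h) n + lam (suc (twice h)) * Π h n ≈
      prefix lam (suc (twice h)) * delay h (tower lam (twice (suc h))) n

    closedForm zero zero = trans Π-00 (sym (*-identityˡ _))
    closedForm zero (suc h) = trans (Π-s0 h) (sym (zeroʳ _))
    closedForm (suc n) zero = begin
      Π 0 (suc n)                            ≈⟨ Π-0s n ⟩
      Π 1 n + lam 1 * Π 0 n                  ≈⟨ oddForm n 0 ⟩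
      lam 1 * 1# * tower lam 2 n             ≈⟨ solve 2 (λ l x → l :* con (+ 1) :* x := con (+ 1) :* (con (+ 0) :+ l :* x)) refl _ _ ⟩
      1# * (0# + lam 1 * tower lam 2 n)      ∎
    closedForm (suc n) (suc h) = begin
      Π (suc h) (suc n)
        ≈⟨ Π-ss h n ⟩
      Π (suc (suc h)) n + (e + o′) * Π (suc h) n + o * e * Π h n
        ≈⟨ solve 6 (λ x e o′ y o z → x :+ (e :+ o′) :* y :+ o :* e :* z := (x :+ o′ :* y) :+ e :* (y :+ o :* z))
             refl _ _ _ _ _ _ ⟩
      (Π (suc (suc h)) n + o′ * Π (suc h) n) + e * (Π (suc h) n + o * Π h n)
        ≈⟨ +-cong (oddForm n (suc h)) (*-congˡ (oddForm n h)) ⟩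
      o′ * (e * (o * L)) * delay (suc h) (tower lam (suc (suc (suc (suc (twice h)))))) n
        + e * (o * L * delay h (tower lam (twice (suc h))) n)
        ≈⟨ solve 6 (λ o′ e o l x y → o′ :* (e :* (o :* l)) :* x :+ e :* (o :* l :* y)
                                   := e :* (o :* l) :* (y :+ o′ :* x)) refl _ _ _ _ _ _ ⟩
      e * (o * L) * (delay (suc h) (tower lam (twice (suc h))) (suc n)
        + o′ * delay (suc (suc h)) (tower lam (suc (suc (suc (suc (twice h)))))) (suc n))
        ≈⟨ *-congˡ (delay-tower lam (suc h) (twice (suc h)) (suc n)) ⟨
      e * (o * L) * delay (suc h) (tower lam (suc (twice (suc h)))) (suc n) ∎
      where
      o = lam (suc (twice h))
      e = lam (twice (suc h))
      o′ = lam (suc (twice (suc h)))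
      L = prefix lam (twice h)

    oddForm n h = begin
      Π (suc h) n + o * Π h n
        ≈⟨ +-cong (closedForm n (suc h)) (*-congˡ (closedForm n h)) ⟩
      e * (o * L) * delay (suc h) (tower lam (suc (twice (suc h)))) n + o * (L * delay h (tower lam (suc (twice h))) n)
        ≈⟨ solve 5 (λ e o l x y → e :* (o :* l) :* x :+ o :* (l :* y) := o :* l :* (y :+ e :* x)) refl _ _ _ _ _ ⟩
      o * L * (delay h (tower lam (suc (twice h))) n + e * delay (suc h) (tower lam (suc (twice (suc h)))) n)
        ≈⟨ *-congˡ (delay-tower lam h (suc (twice h)) n) ⟨
      o * L * delay h (tower lam (twice (suc h))) n ∎
      where
      o = lam (suc (twice h))
      e = lam (twice (suc h))
      L = prefix lam (twice h)

    Π≈tower : ∀ n → Π 0 n ≈ tower lam 1 n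
    Π≈tower n = trans (closedForm n 0) (*-identityˡ _)

-- Successor and predecessor on the integers.

up : ℤ → ℤ
up (+ n) = + suc n
up -[1+ zero ] = + 0
up -[1+ suc n ] = -[1+ n ]

down : ℤ → ℤ
down (+ zero) = -[1+ 0 ]
down (+ suc n) = + n
down -[1+ n ] = -[1+ suc n ]

up-down : ∀ k → up (down k) ≡ k
up-down (+ zero) = ≡.refl
up-down (+ suc n) = ≡.refl
up-down -[1+ n ] = ≡.refl

down-up : ∀ k → down (up k) ≡ k
down-up (+ n) = ≡.refl
down-up -[1+ zero ] = ≡.refl
down-up -[1+ suc n ] = ≡.refl

-- Identities modulo given equations.

module Certificates {c ℓ : Level} (R : CommutativeRing c ℓ) where
  open CommutativeRing R hiding (zero)

  -- A goal L ≈ M is reduced to an unconditional ring identity L ≈ M + Σ aᵢ (lᵢ - rᵢ) with lᵢ ≈ rᵢ.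
  infixl 5 _⊞_
  infix 6 _·_

  _·_ : ∀ a {l r} → l ≈ r → a * (l - r) ≈ 0#
  a · l≈r = trans (*-congˡ (trans (+-congʳ l≈r) (-‿inverseʳ _))) (zeroʳ a)

  _⊞_ : ∀ {x y} → x ≈ 0# → y ≈ 0# → x + y ≈ 0#
  x≈0 ⊞ y≈0 = trans (+-cong x≈0 y≈0) (+-identityʳ 0#)

  certify : ∀ {L M Δ} → Δ ≈ 0# → L ≈ M + Δ → L ≈ M
  certify Δ≈0 eq = trans eq (trans (+-congˡ Δ≈0) (+-identityʳ _))

-- Functionals on Laurent polynomials, as sequences indexed by the integers.

module Bilateral {c ℓ : Level} (R : CommutativeRing c ℓ) where
  open CommutativeRing R hiding (zero)
  open CF R
  open IntegerSolver R
  open Certificates R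
  open Series R
  open Algebra.Properties.Ring ring using (-0#≈0#)
  open Relation.Binary.Reasoning.Setoid setoid

  pow-inverse : ∀ {x x'} → x * x' ≈ 1# → ∀ n → pow x n * pow x' n ≈ 1#
  pow-inverse xx' zero = *-identityˡ _
  pow-inverse {x} {x'} xx' (suc n) = certify (pow x n * pow x' n · xx' ⊞ 1# · pow-inverse xx' n)
    (solve 4 (λ x x' a b → (x :* a) :* (x' :* b) := con (+ 1) :+ (a :* b :* (x :* x' :- con (+ 1)) :+ con (+ 1) :* (a :* b :- con (+ 1)))) refl _ _ _ _)

  zpow-up : ∀ {x x'} → x * x' ≈ 1# → ∀ k → zpow x x' (up k) ≈ x * zpow x x' k
  zpow-up xx' (+ n) = refl
  zpow-up {x} {x'} xx' -[1+ zero ] = sym (trans (*-congˡ (*-identityʳ x')) xx')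
  zpow-up {x} {x'} xx' -[1+ suc n ] = sym (trans (sym (*-assoc x x' _)) (trans (*-congʳ xx') (*-identityˡ _)))

  zpow-down : ∀ {x x'} → x * x' ≈ 1# → ∀ k → x * zpow x x' (down k) ≈ zpow x x' k
  zpow-down {x} {x'} xx' k = trans (sym (zpow-up xx' (down k))) (reflexive (≡.cong (zpow x x') (up-down k)))

  -- Multiplication by t = v + 2 + v⁻¹, with v and v⁻¹ acting as shifts.
  Δ : (ℤ → Carrier) → ℤ → Carrier
  Δ f k = f (up k) + (1# + 1#) * f k + f (down k)

  Δ-linear : ∀ {f g h i a b d} → (∀ k → f k ≈ a * g k + b * h k + d * i k) →
    ∀ k → Δ f k ≈ a * Δ g k + b * Δ h k + d * Δ i k
  Δ-linear {f} {g} {h} {i} {a} {b} {d} eq k =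
    trans (+-cong (+-cong (eq (up k)) (*-congˡ (eq k))) (eq (down k)))
      (solve 12 (λ a b d g₁ h₁ i₁ g₀ h₀ i₀ g₂ h₂ i₂ →
        (a :* g₁ :+ b :* h₁ :+ d :* i₁) :+ con (+ 2) :* (a :* g₀ :+ b :* h₀ :+ d :* i₀) :+ (a :* g₂ :+ b :* h₂ :+ d :* i₂)
        := a :* (g₁ :+ con (+ 2) :* g₀ :+ g₂) :+ b :* (h₁ :+ con (+ 2) :* h₀ :+ h₂) :+ d :* (i₁ :+ con (+ 2) :* i₀ :+ i₂))
        refl a b d (g (up k)) (h (up k)) (i (up k)) (g k) (h k) (i k) (g (down k)) (h (down k)) (i (down k)))

  -- If f stands for a Laurent polynomial, ev n f is L of tⁿ times that polynomial.
  ev : ℕ → (ℤ → Carrier) → Carrier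
  ev zero f = f (+ 0) - f -[1+ 0 ]
  ev (suc n) f = ev n (Δ f)

  ev-linear : ∀ n {f g h i a b d} → (∀ k → f k ≈ a * g k + b * h k + d * i k) →
    ev n f ≈ a * ev n g + b * ev n h + d * ev n i
  ev-linear zero {f} {g} {h} {i} {a} {b} {d} eq =
    trans (+-cong (eq (+ 0)) (-‿cong (eq -[1+ 0 ])))
      (solve 9 (λ a b d g₀ h₀ i₀ g₁ h₁ i₁ →
        (a :* g₀ :+ b :* h₀ :+ d :* i₀) :- (a :* g₁ :+ b :* h₁ :+ d :* i₁)
        := a :* (g₀ :- g₁) :+ b :* (h₀ :- h₁) :+ d :* (i₀ :- i₁)) refl _ _ _ _ _ _ _ _ _)
  ev-linear (suc n) eq = ev-linear n (Δ-linear eq)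

  -- The partial theta functional and its orthogonal polynomials.

  module Moments (p p' x x' : Carrier) (pp' : p * p' ≈ 1#) (xx' : x * x' ≈ 1#) where

    σ : Carrier
    σ = x + p * x'

    ϑ : Carrier → Carrier
    ϑ X = 1# + X * σ + p * (X * X)

    -- b(k) = p^{k(k+1)/2} Σ_{0≤i≤k} xⁱ p^{-i(i+1)/2}, where Σ_{0≤i≤-1-m} stands for -Σ_{-m≤i≤-1}.
    b : ℤ → Carrier
    b (+ zero) = 1#
    b (+ suc n) = pow p (suc n) * b (+ n) + pow x (suc n)
    b -[1+ zero ] = 0#
    b -[1+ suc n ] = pow p (suc n) * (b -[1+ n ] - pow x' (suc n))

    b-up : ∀ k → b (up k) ≈ zpow p p' (up k) * b k + zpow x x' (up k)
    b-up (+ n) = refl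
    b-up -[1+ zero ] = sym (trans (+-congʳ (zeroʳ _)) (+-identityˡ _))
    b-up -[1+ suc n ] = certify ((b -[1+ n ] - pow x' (suc n)) * (- 1#) · pow-inverse pp' (suc n))
      (solve 4 (λ P P' β X → β := (P' :* (P :* (β :- X)) :+ X) :+ (β :- X) :* (:- con (+ 1)) :* (P :* P' :- con (+ 1))) refl _ _ _ _)

    b-rec : ∀ k → b k ≈ zpow p p' k * b (down k) + zpow x x' k
    b-rec k = ≡.subst (λ i → b i ≈ zpow p p' i * b (down k) + zpow x x' i) (up-down k) (b-up (down k))

    -- A sequence stands for a Laurent polynomial f(v) through k ↦ L_b(v^k f); up acts as v, down as v⁻¹.
    -- Then W j stands for Π_{1≤i≤j} (1 + pⁱ v) · Π_{0≤i≤j} (1 + pⁱ v⁻¹), and B j for ψ_j.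
    -- By b-rec, L_b(g) = L_b(g(pv)/v) + g(x); Twisted is this equation for g = v^k (v + P) f when
    -- (v + P) f turns into (v⁻¹ + P) f under g ↦ g(pv)/v.
    Twisted : (ℤ → Carrier) → Carrier → Carrier → Set ℓ
    Twisted w P e = ∀ k → w (up k) + P * w k ≈ zpow p p' k * (w (down k) + P * w k) + zpow x x' k * e

    W₀ : ℤ → Carrier
    W₀ k = b k + b (down k)

    -- Multiplication by (1 + P v)(1 + P v⁻¹).
    next : Carrier → (ℤ → Carrier) → ℤ → Carrier
    next P w k = P * (w (up k) + w (down k)) + (1# + P * P) * w k

    -- The recursion of `b` at k + 1, k, k - 1 is weighted by the coefficients of (v + p)(1 + v⁻¹) =
    -- v + (1 + p) + p v⁻¹; the last argument is the value of this product at v = x.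
    twisted-W₀ : Twisted W₀ p (x + 1# + p * x' + p)
    twisted-W₀ k = trans (+-congʳ (+-congˡ (reflexive (≡.cong b (down-up k)))))
      (certify (1# · b-up k ⊞ (1# + p) · b-rec k ⊞ p · b-rec (down k)
                ⊞ b k · zpow-up pp' k ⊞ 1# · zpow-up xx' k
                ⊞ b (down (down k)) · zpow-down pp' k ⊞ (p * x') · zpow-down xx' k
                ⊞ (- (p * zpow x x' (down k))) · xx')
        (solve 13 (λ p x x' A A⁺ A⁻ u u⁺ u⁻ b₁ b₀ b₋ b₌ →
           (b₁ :+ b₀) :+ p :* (b₀ :+ b₋)
           := (A :* ((b₋ :+ b₌) :+ p :* (b₀ :+ b₋)) :+ u :* (x :+ con (+ 1) :+ p :* x' :+ p))
              :+ (con (+ 1) :* (b₁ :- (A⁺ :* b₀ :+ u⁺)) :+ (con (+ 1) :+ p) :* (b₀ :- (A :* b₋ :+ u)) :+ p :* (b₋ :- (A⁻ :* b₌ :+ u⁻))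
                  :+ b₀ :* (A⁺ :- p :* A) :+ con (+ 1) :* (u⁺ :- x :* u)
                  :+ b₌ :* (p :* A⁻ :- A) :+ (p :* x') :* (x :* u⁻ :- u)
                  :+ (:- (p :* u⁻)) :* (x :* x' :- con (+ 1))))
          refl p x x' (zpow p p' k) (zpow p p' (up k)) (zpow p p' (down k)) (zpow x x' k) (zpow x x' (up k)) (zpow x x' (down k))
            (b (up k)) (b k) (b (down k)) (b (down (down k)))))

    -- The new relation is (1 + P v)(1 + p P v⁻¹) times the old one.
    twisted-next : ∀ {w P e} → Twisted w P e →
      Twisted (next P w) (p * P) (e * (1# + p * (P * P) + P * x + p * P * x'))
    twisted-next {w} {P} {e} rel k =
      trans (+-congʳ (+-congʳ (*-congˡ (+-congˡ (reflexive (≡.cong w (down-up k)))))))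
      (trans
      (certify (P · rel-up ⊞ (1# + p * (P * P)) · rel k ⊞ (p * P) · rel-down
                ⊞ (P * (w k + P * w (up k))) · zpow-up pp' k ⊞ (P * e) · zpow-up xx' k
                ⊞ (P * (w (down (down k)) + P * w (down k))) · zpow-down pp' k
                ⊞ (p * P * e * x') · zpow-down xx' k ⊞ (- (p * P * e * zpow x x' (down k))) · xx')
        (solve 16 (λ p P e x x' A A⁺ A⁻ u u⁺ u⁻ w₂ w₁ w₀ w₋ w₌ →
          (P :* (w₂ :+ w₀) :+ (con (+ 1) :+ P :* P) :* w₁) :+ p :* P :* (P :* (w₁ :+ w₋) :+ (con (+ 1) :+ P :* P) :* w₀)
          := (A :* ((P :* (w₀ :+ w₌) :+ (con (+ 1) :+ P :* P) :* w₋) :+ p :* P :* (P :* (w₁ :+ w₋) :+ (con (+ 1) :+ P :* P) :* w₀))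
               :+ u :* (e :* (con (+ 1) :+ p :* (P :* P) :+ P :* x :+ p :* P :* x')))
             :+ (P :* (w₂ :+ P :* w₁ :- (A⁺ :* (w₀ :+ P :* w₁) :+ u⁺ :* e))
                 :+ (con (+ 1) :+ p :* (P :* P)) :* (w₁ :+ P :* w₀ :- (A :* (w₋ :+ P :* w₀) :+ u :* e))
                 :+ p :* P :* (w₀ :+ P :* w₋ :- (A⁻ :* (w₌ :+ P :* w₋) :+ u⁻ :* e))
                 :+ (P :* (w₀ :+ P :* w₁)) :* (A⁺ :- p :* A) :+ (P :* e) :* (u⁺ :- x :* u)
                 :+ (P :* (w₌ :+ P :* w₋)) :* (p :* A⁻ :- A)
                 :+ (p :* P :* e :* x') :* (x :* u⁻ :- u) :+ (:- (p :* P :* e :* u⁻)) :* (x :* x' :- con (+ 1))))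
          refl p P e x x' (zpow p p' k) (zpow p p' (up k)) (zpow p p' (down k)) (zpow x x' k) (zpow x x' (up k)) (zpow x x' (down k))
            (w (up (up k))) (w (up k)) (w k) (w (down k)) (w (down (down k)))))
      (+-congʳ (*-congˡ (+-congʳ (+-congʳ (*-congˡ (+-congʳ (reflexive (≡.cong w (≡.sym (up-down k)))))))))))
      where
      rel-up : w (up (up k)) + P * w (up k) ≈ zpow p p' (up k) * (w k + P * w (up k)) + zpow x x' (up k) * e
      rel-up = ≡.subst (λ i → w (up (up k)) + P * w (up k) ≈ zpow p p' (up k) * (w i + P * w (up k)) + zpow x x' (up k) * e)
        (down-up k) (rel (up k))
      rel-down : w k + P * w (down k) ≈ zpow p p' (down k) * (w (down (down k)) + P * w (down k)) + zpow x x' (down k) * e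
      rel-down = ≡.subst (λ i → w i + P * w (down k) ≈ zpow p p' (down k) * (w (down (down k)) + P * w (down k)) + zpow x x' (down k) * e)
        (up-down k) (rel (down k))

    -- This is L_b((v - v⁻¹) f), hence L((1 + v) f), because (1 - v⁻¹)(1 + v) = v - v⁻¹.
    gap : (ℤ → Carrier) → Carrier
    gap w = w (+ 1) - w -[1+ 0 ]

    -- The combination of the relations at 1, -1, 0 with weights 1, p, -σ eliminates e.
    gap-next : ∀ {w P e} → Twisted w P e → gap (next P w) ≈ ϑ P * gap w
    gap-next {w} {P} {e} rel =
      certify (P · rel (+ 1) ⊞ (P * p) · rel -[1+ 0 ] ⊞ (- (P * σ)) · rel (+ 0)
               ⊞ (P * (w -[1+ 1 ] + P * w -[1+ 0 ])) · pp')
        (solve 11 (λ P p p' x x' e w₂ w₁ w₀ w₋ w₌ →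
          (P :* (w₂ :+ w₀) :+ (con (+ 1) :+ P :* P) :* w₁) :- (P :* (w₀ :+ w₌) :+ (con (+ 1) :+ P :* P) :* w₋)
          := (con (+ 1) :+ P :* (x :+ p :* x') :+ p :* (P :* P)) :* (w₁ :- w₋)
             :+ (P :* (w₂ :+ P :* w₁ :- (p :* con (+ 1) :* (w₀ :+ P :* w₁) :+ x :* con (+ 1) :* e))
                 :+ (P :* p) :* (w₀ :+ P :* w₋ :- (p' :* con (+ 1) :* (w₌ :+ P :* w₋) :+ x' :* con (+ 1) :* e))
                 :+ (:- (P :* (x :+ p :* x'))) :* (w₁ :+ P :* w₀ :- (con (+ 1) :* (w₋ :+ P :* w₀) :+ con (+ 1) :* e))
                 :+ (P :* (w₌ :+ P :* w₋)) :* (p :* p' :- con (+ 1))))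
          refl P p p' x x' e (w (+ 2)) (w (+ 1)) (w (+ 0)) (w -[1+ 0 ]) (w -[1+ 1 ]))

    W : ℕ → ℤ → Carrier
    W zero = W₀
    W (suc j) = next (pow p (suc j)) (W j)

    -- The value at v = x of v + p^{j+1} times the Laurent polynomial of `W j`.
    eigen : ℕ → Carrier
    eigen zero = x + 1# + p * x' + p
    eigen (suc j) = let P = pow p (suc j) in eigen j * (1# + p * (P * P) + P * x + p * P * x')

    twisted-W : ∀ j → Twisted (W j) (pow p (suc j)) (eigen j)
    twisted-W zero k = trans (+-congˡ (*-congʳ (*-identityʳ p)))
      (trans (twisted-W₀ k) (+-congʳ (*-congˡ (+-congˡ (*-congʳ (sym (*-identityʳ p)))))))
    twisted-W (suc j) = twisted-next (twisted-W j)

    -- The factor (1 + p^j v)(1 + p^j v⁻¹) is written as p^j t + (1 - p^j)², which ties the basis to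
    -- `Δ`.
    B : ℕ → ℤ → Carrier
    B zero = b
    B (suc j) k = pow p j * Δ (B j) k + (1# - pow p j) * (1# - pow p j) * B j k

    -- The product ψ_{j+1} is 1 + v times the Laurent polynomial of `W j`, which lacks just this
    -- factor.
    B≈W : ∀ j k → B (suc j) k ≈ W j k + W j (up k)
    B≈W zero k = trans
      (solve 3 (λ b₁ b₀ b₋ →
        con (+ 1) :* (b₁ :+ con (+ 2) :* b₀ :+ b₋) :+ (con (+ 1) :- con (+ 1)) :* (con (+ 1) :- con (+ 1)) :* b₀
        := b₀ :+ b₋ :+ (b₁ :+ b₀)) refl (b (up k)) (b k) (b (down k)))
      (+-congˡ (+-congˡ (reflexive (≡.cong b (≡.sym (down-up k))))))
    B≈W (suc j) k = begin
      P * Δ (B (suc j)) k + (1# - P) * (1# - P) * B (suc j) k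
        ≈⟨ +-cong (*-congˡ (+-cong (+-cong (B≈W j (up k)) (*-congˡ (B≈W j k))) (trans (B≈W j (down k)) (+-congˡ (reflexive (≡.cong w (up-down k)))))))
             (*-congˡ (B≈W j k)) ⟩
      P * ((w (up k) + w (up (up k))) + (1# + 1#) * (w k + w (up k)) + (w (down k) + w k)) + (1# - P) * (1# - P) * (w k + w (up k))
        ≈⟨ solve 5 (λ P w₂ w₁ w₀ w₋ →
             P :* ((w₁ :+ w₂) :+ con (+ 2) :* (w₀ :+ w₁) :+ (w₋ :+ w₀)) :+ (con (+ 1) :- P) :* (con (+ 1) :- P) :* (w₀ :+ w₁)
             := P :* (w₁ :+ w₋) :+ (con (+ 1) :+ P :* P) :* w₀ :+ (P :* (w₂ :+ w₀) :+ (con (+ 1) :+ P :* P) :* w₁))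
             refl P (w (up (up k))) (w (up k)) (w k) (w (down k)) ⟩
      next P w k + (P * (w (up (up k)) + w k) + (1# + P * P) * w (up k))
        ≈⟨ +-congˡ (+-congʳ (*-congˡ (+-congˡ (reflexive (≡.cong w (≡.sym (down-up k))))))) ⟩
      next P w k + next P w (up k) ∎
      where
      P = pow p (suc j)
      w = W j

    ev₀-B≈gap : ∀ j → ev 0 (B (suc j)) ≈ gap (W j)
    ev₀-B≈gap j = trans (+-cong (B≈W j (+ 0)) (-‿cong (B≈W j -[1+ 0 ])))
      (solve 3 (λ w₁ w₀ w₋ → (w₀ :+ w₁) :- (w₋ :+ w₀) := w₁ :- w₋) refl _ _ _)

    -- From the second step on this is `gap-next`, since L(ψ_{j+1}) is the gap of `W j`. The first
    -- step is computed from values of `b`, as ψ_0 = 1 has no factor 1 + v.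
    ev₀-B : ∀ j → ev 0 (B (suc j)) ≈ ϑ (pow p j) * ev 0 (B j)
    ev₀-B zero = trans (ev₀-B≈gap 0)
      (solve 3 (λ p x x' →
        ((p :* con (+ 1)) :* con (+ 1) :+ x :* con (+ 1) :+ con (+ 1)) :- (con (+ 0) :+ (p :* con (+ 1)) :* (con (+ 0) :- x' :* con (+ 1)))
        := (con (+ 1) :+ con (+ 1) :* (x :+ p :* x') :+ p :* (con (+ 1) :* con (+ 1))) :* (con (+ 1) :- con (+ 0))) refl p x x')
    ev₀-B (suc j) = trans (ev₀-B≈gap (suc j)) (trans (gap-next (twisted-W j)) (*-congˡ (sym (ev₀-B≈gap j))))

    -- G h 0 stands for the monic orthogonal polynomial of degree h in t; the index j makes the recurrence inductive.
    G : ℕ → ℕ → ℤ → Carrier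
    G zero j = B j
    G (suc h) j k = pow p' h * G h (suc j) k - ϑ (pow p j * pow p h) * G h j k

    -- The lowest term of the three-term recurrence, set to zero at h = 0. For j = 0 the coefficient
    -- in `K (suc h)` is λ_{2h+1} λ_{2h+2}.
    K : ℕ → ℕ → ℤ → Carrier
    K zero j k = 0#
    K (suc h) j k = ϑ (pow p j * pow p h) * ((1# - pow p (suc h)) * (1# - pow p (suc h))) * G h j k

    -- The middle coefficient, with H = p^h and J = p^j. At J = 1 it is (1 - H)² + ϑ(H), that is
    -- λ_{2h} + λ_{2h+1}.
    β : Carrier → Carrier → Carrier
    β H J = 1# + 1# + σ * H + p * (J * (H * H)) + J * (H * H) - (1# + 1#) * (J * H)

    -- The definition of `G`, solved for its term at j + 1, brings `K` back from j + 1 to j, as the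
    -- induction in `Δ-G` requires.
    K-shift : ∀ h j k → p * pow p' h * K h (suc j) k ≈
      ϑ (pow p j * pow p h) * ((1# - pow p h) * (1# - pow p h) * G h j k + K h j k)
    K-shift zero j k = solve 3 (λ p t g → p :* con (+ 1) :* con (+ 0)
      := t :* ((con (+ 1) :- con (+ 1)) :* (con (+ 1) :- con (+ 1)) :* g :+ con (+ 0))) refl p _ (G 0 j k)
    K-shift (suc h) j k =
      certify ((H' * (ϑ (p * J * H) * D * g⁺)) · pp')
        (solve 9 (λ p p' σ H H' J D g⁺ g →
           let th X = con (+ 1) :+ X :* σ :+ p :* (X :* X) in
           p :* (p' :* H') :* (th (p :* J :* H) :* D :* g⁺)
           := th (J :* (p :* H)) :* (D :* (H' :* g⁺ :- th (J :* H) :* g) :+ th (J :* H) :* D :* g)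
              :+ (H' :* (th (p :* J :* H) :* D :* g⁺)) :* (p :* p' :- con (+ 1)))
           refl p p' σ H H' J D g⁺ (G h j k))
      where
      H = pow p h
      H' = pow p' h
      J = pow p j
      D = (1# - p * H) * (1# - p * H)
      g⁺ = G h (suc j) k

    -- Induction on h for all j at once, since `G (suc h) j` combines `G h` at j + 1 and j. The base
    -- case is the definition of `B` solved for t ψ_j.
    Δ-G : ∀ h j k → Δ (G h j) k ≈
      pow p' j * G (suc h) j k + β (pow p h) (pow p j) * G h j k + pow p j * K h j k
    Δ-G zero j k =
      certify (((1# + 1# + σ + p * J - J) * B j k - Δ (B j) k) · pow-inverse pp' j)
        (solve 6 (λ p σ J J' t g →
           let b⁺ = J :* t :+ (con (+ 1) :- J) :* (con (+ 1) :- J) :* g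
               X = J :* con (+ 1)
               r = con (+ 2) :+ σ :+ p :* J :- J in
           t := J' :* (con (+ 1) :* b⁺ :- (con (+ 1) :+ X :* σ :+ p :* (X :* X)) :* g)
                :+ (con (+ 2) :+ σ :* con (+ 1) :+ p :* (J :* (con (+ 1) :* con (+ 1))) :+ J :* (con (+ 1) :* con (+ 1)) :- con (+ 2) :* (J :* con (+ 1))) :* g
                :+ J :* con (+ 0)
                :+ (r :* g :- t) :* (J :* J' :- con (+ 1)))
           refl p σ J (pow p' j) (Δ (B j) k) (B j k))
      where
      J = pow p j
    Δ-G (suc h) j k = begin
      Δ (G (suc h) j) k
        ≈⟨ solve 8 (λ a c f₁ g₁ f₀ g₀ f₂ g₂ →
             (a :* f₁ :- c :* g₁) :+ con (+ 2) :* (a :* f₀ :- c :* g₀) :+ (a :* f₂ :- c :* g₂)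
             := a :* (f₁ :+ con (+ 2) :* f₀ :+ f₂) :- c :* (g₁ :+ con (+ 2) :* g₀ :+ g₂))
             refl H' (ϑ (J * H)) (G h (suc j) (up k)) (G h j (up k)) (G h (suc j) k) (G h j k) (G h (suc j) (down k)) (G h j (down k)) ⟩
      H' * Δ (G h (suc j)) k - ϑ (J * H) * Δ (G h j) k
        ≈⟨ +-cong (*-congˡ (Δ-G h (suc j) k)) (-‿cong (*-congˡ (Δ-G h j k))) ⟩
      H' * (p' * J' * G (suc h) (suc j) k + β H (p * J) * G h (suc j) k + p * J * K h (suc j) k)
        - ϑ (J * H) * (J' * G (suc h) j k + β H J * G h j k + J * K h j k)
        ≈⟨ certify (J · K-shift h j k
                    ⊞ (((p - 1#) * H * σ + (p * p - 1#) * p * J * (H * H)) * G (suc h) j k) · pow-inverse pp' j)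
          (solve 12 (λ p p' σ H H' J J' g g⁺ g₁⁺ κ κ⁺ →
            let th X = con (+ 1) :+ X :* σ :+ p :* (X :* X)
                be H J = con (+ 2) :+ σ :* H :+ p :* (J :* (H :* H)) :+ J :* (H :* H) :- con (+ 2) :* (J :* H)
                g₁ = H' :* g⁺ :- th (J :* H) :* g in
            H' :* (p' :* J' :* g₁⁺ :+ be H (p :* J) :* g⁺ :+ p :* J :* κ⁺) :- th (J :* H) :* (J' :* g₁ :+ be H J :* g :+ J :* κ)
            := J' :* (p' :* H' :* g₁⁺ :- th (J :* (p :* H)) :* g₁) :+ be (p :* H) J :* g₁
                 :+ J :* (th (J :* H) :* ((con (+ 1) :- p :* H) :* (con (+ 1) :- p :* H)) :* g)
               :+ (J :* (p :* H' :* κ⁺ :- th (J :* H) :* ((con (+ 1) :- H) :* (con (+ 1) :- H) :* g :+ κ))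
                   :+ (((p :- con (+ 1)) :* H :* σ :+ (p :* p :- con (+ 1)) :* p :* J :* (H :* H)) :* g₁) :* (J :* J' :- con (+ 1))))
            refl p p' σ H H' J J' (G h j k) (G h (suc j) k) (G (suc h) (suc j) k) (K h j k) (K h (suc j) k)) ⟩
      J' * G (suc (suc h)) j k + β (p * H) J * G (suc h) j k + J * K (suc h) j k ∎
      where
      H = pow p h
      H' = pow p' h
      J = pow p j
      J' = pow p' j

    -- For h = 0 the argument is ψ_{j+1} - ϑ(p^j) ψ_j, killed by `ev₀-B`; the later ones are linear
    -- combinations of these.
    ev₀-G : ∀ h j → ev 0 (G (suc h) j) ≈ 0#
    ev₀-G zero j = certify (1# · ev₀-B j)
      (solve 7 (λ p σ J f₀ f₁ g₀ g₁ →
        let th X = con (+ 1) :+ X :* σ :+ p :* (X :* X) in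
        (con (+ 1) :* f₀ :- th (J :* con (+ 1)) :* g₀) :- (con (+ 1) :* f₁ :- th (J :* con (+ 1)) :* g₁)
        := con (+ 0) :+ con (+ 1) :* (f₀ :- f₁ :- th J :* (g₀ :- g₁)))
        refl p σ (pow p j) (B (suc j) (+ 0)) (B (suc j) -[1+ 0 ]) (B j (+ 0)) (B j -[1+ 0 ]))
    ev₀-G (suc h) j = certify (a · ev₀-G h (suc j) ⊞ (- d) · ev₀-G h j)
      (solve 6 (λ a d f₀ f₁ g₀ g₁ → (a :* f₀ :- d :* g₀) :- (a :* f₁ :- d :* g₁)
        := con (+ 0) :+ (a :* (f₀ :- f₁ :- con (+ 0)) :+ (:- d) :* (g₀ :- g₁ :- con (+ 0))))
        refl a d (G (suc h) (suc j) (+ 0)) (G (suc h) (suc j) -[1+ 0 ]) (G (suc h) j (+ 0)) (G (suc h) j -[1+ 0 ]))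
      where
      a = pow p' (suc h)
      d = ϑ (pow p j * pow p (suc h))

    ev-b≈tower : ∀ lam → (∀ h → lam (twice h) ≈ (1# - pow p h) * (1# - pow p h)) →
      (∀ h → lam (suc (twice h)) ≈ ϑ (pow p h)) → ∀ n → ev n b ≈ tower lam 1 n
    ev-b≈tower lam even odd = Π≈tower lam (λ h n → ev n (G h 0))
      (trans (+-congˡ -0#≈0#) (+-identityʳ _))
      (λ h → ev₀-G h 0)
      (λ n → trans (ev-linear n (λ k → trans (Δ-G 0 0 k) (first k)))
               (solve 4 (λ a d e f → con (+ 1) :* a :+ d :* e :+ con (+ 0) :* f := a :+ d :* e) refl _ _ _ (ev n b)))
      (λ h n → trans (ev-linear n (λ k → trans (Δ-G (suc h) 0 k) (later h k)))
               (+-congʳ (+-congʳ (*-identityˡ _))))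
      where
      -- The summand `0# * b k` is padding, so that the three-term `ev-linear` covers h = 0.
      first : ∀ k → 1# * G 1 0 k + β 1# 1# * b k + 1# * 0# ≈ 1# * G 1 0 k + lam 1 * b k + 0# * b k
      first k = certify ((- b k) · odd 0)
        (solve 5 (λ p σ l g₁ g →
          con (+ 1) :* g₁ :+ (con (+ 2) :+ σ :* con (+ 1) :+ p :* (con (+ 1) :* (con (+ 1) :* con (+ 1))) :+ con (+ 1) :* (con (+ 1) :* con (+ 1)) :- con (+ 2) :* (con (+ 1) :* con (+ 1))) :* g :+ con (+ 1) :* con (+ 0)
          := con (+ 1) :* g₁ :+ l :* g :+ con (+ 0) :* g
             :+ (:- g) :* (l :- (con (+ 1) :+ con (+ 1) :* σ :+ p :* (con (+ 1) :* con (+ 1)))))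
          refl p σ (lam 1) (G 1 0 k) (b k))
      later : ∀ h k → let H = pow p (suc h) in
        1# * G (suc (suc h)) 0 k + β H 1# * G (suc h) 0 k + 1# * K (suc h) 0 k
        ≈ 1# * G (suc (suc h)) 0 k + (lam (twice (suc h)) + lam (suc (twice (suc h)))) * G (suc h) 0 k
          + lam (suc (twice h)) * lam (twice (suc h)) * G h 0 k
      later h k = certify ((- G (suc h) 0 k) · even (suc h) ⊞ (- G (suc h) 0 k) · odd (suc h)
                           ⊞ (- (lam (twice (suc h)) * G h 0 k)) · odd h ⊞ (- (ϑ H₁ * G h 0 k)) · even (suc h))
        (solve 9 (λ p σ H₁ l₁ l₂ l₃ g₂ g₁ g →
          let H = p :* H₁
              J = con (+ 1)
              th X = con (+ 1) :+ X :* σ :+ p :* (X :* X)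
              D = (con (+ 1) :- H) :* (con (+ 1) :- H) in
          J :* g₂ :+ (con (+ 2) :+ σ :* H :+ p :* (J :* (H :* H)) :+ J :* (H :* H) :- con (+ 2) :* (J :* H)) :* g₁ :+ J :* (th (J :* H₁) :* D :* g)
          := J :* g₂ :+ (l₂ :+ l₃) :* g₁ :+ l₁ :* l₂ :* g
             :+ ((:- g₁) :* (l₂ :- D) :+ (:- g₁) :* (l₃ :- th H) :+ (:- (l₂ :* g)) :* (l₁ :- th H₁) :+ (:- (th H₁ :* g)) :* (l₂ :- D)))
          refl p σ H₁ (lam (suc (twice h))) (lam (twice (suc h))) (lam (suc (twice (suc h)))) (G (suc (suc h)) 0 k) (G (suc h) 0 k) (G h 0 k))
        where
        H₁ = pow p h

-- Integer differences and binomial coefficients.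

suc-⊖ : ∀ n k → suc n ⊖ k ≡ up (n ⊖ k)
suc-⊖ n zero = ≡.refl
suc-⊖ zero (suc zero) = ≡.refl
suc-⊖ zero (suc (suc k)) = ≡.refl
suc-⊖ (suc n) (suc k) = ≡.trans (ℤ.[1+m]⊖[1+n]≡m⊖n (suc n) k)
  (≡.trans (suc-⊖ n k) (≡.cong up (≡.sym (ℤ.[1+m]⊖[1+n]≡m⊖n n k))))

⊖-suc : ∀ n k → n ⊖ suc k ≡ down (n ⊖ k)
⊖-suc n k = ≡.trans (≡.sym (down-up (n ⊖ suc k)))
  (≡.cong down (≡.trans (≡.sym (suc-⊖ n (suc k))) (ℤ.[1+m]⊖[1+n]≡m⊖n n k)))

⊖-negative : ∀ n k → n < k → ∃ λ m → n ⊖ k ≡ -[1+ m ]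
⊖-negative zero (suc k) _ = k , ≡.refl
⊖-negative (suc n) (suc k) (s≤s n<k) with ⊖-negative n k n<k
... | m , eq = m , ≡.trans (ℤ.[1+m]⊖[1+n]≡m⊖n n k) eq

i-1≡down : ∀ i → i ℤ.- + 1 ≡ down i
i-1≡down (+ zero) = ≡.refl
i-1≡down (+ suc n) = ≡.refl
i-1≡down -[1+ n ] = ≡.cong (λ m → -[1+ suc m ]) (ℕ.+-identityʳ n)

m+n⊖n : ∀ m n → (m ℕ.+ n) ⊖ n ≡ + m
m+n⊖n m zero = ≡.cong +_ (ℕ.+-identityʳ m)
m+n⊖n m (suc n) = ≡.trans (≡.cong (_⊖ suc n) (ℕ.+-suc m n))
  (≡.trans (ℤ.[1+m]⊖[1+n]≡m⊖n (m ℕ.+ n) n) (m+n⊖n m n))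

binZ-pascal : ∀ N i → binZ (suc N) (up i) ≡ binZ N i ℕ.+ binZ N (up i)
binZ-pascal N (+ k) = ≡.sym (nCk+nC[k+1]≡[n+1]C[k+1] N k)
binZ-pascal N -[1+ zero ] = ≡.refl
binZ-pascal N -[1+ suc m ] = ≡.refl

binZ-central-sym : ∀ n → binZ (2 ℕ.* n) (up (+ n)) ≡ binZ (2 ℕ.* n) (down (+ n))
binZ-central-sym zero = ≡.refl
binZ-central-sym (suc n) = ≡.trans (nCk≡nC[n∸k] (ℕ.≤-trans (ℕ.m≤m+n (suc (suc n)) n) (ℕ.≤-reflexive 2+n+n≡2[1+n])))
  (≡.cong (2 ℕ.* suc n C_) (≡.trans (≡.cong (ℕ._∸ suc (suc n)) (≡.sym 2+n+n≡2[1+n])) (ℕ.m+n∸m≡n (suc (suc n)) n)))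
  where
  2+n+n≡2[1+n] : suc (suc n) ℕ.+ n ≡ 2 ℕ.* suc n
  2+n+n≡2[1+n] = +-*-Solver.solve 1 (λ n → +-*-Solver.con 2 +-*-Solver.:+ n +-*-Solver.:+ n
    +-*-Solver.:= +-*-Solver.con 2 +-*-Solver.:* (+-*-Solver.con 1 +-*-Solver.:+ n)) ≡.refl n

-- Ballot numbers as coordinates of tⁿ.

module Ballot {c ℓ : Level} (R : CommutativeRing c ℓ) where
  open CommutativeRing R hiding (zero)
  open CF R
  open IntegerSolver R
  open Certificates R
  open Series R
  open Bilateral R
  open Relation.Binary.Reasoning.Setoid setoid

  fromℕ-+ : ∀ m n → fromℕ (m ℕ.+ n) ≈ fromℕ m + fromℕ n
  fromℕ-+ zero n = sym (+-identityˡ _)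
  fromℕ-+ (suc m) n = trans (+-congˡ (fromℕ-+ m n)) (sym (+-assoc _ _ _))

  bin : ℕ → ℤ → Carrier
  bin N i = fromℕ (binZ N i)

  bin-pascal : ∀ N i → bin (suc N) i ≈ bin N (down i) + bin N i
  bin-pascal N i = ≡.subst (λ j → bin (suc N) j ≈ bin N (down i) + bin N j) (up-down i)
    (trans (reflexive (≡.cong fromℕ (binZ-pascal N (down i)))) (fromℕ-+ (binZ N (down i)) _))

  -- Two Pascal steps, the counterpart of one factor t.
  bin-pascal² : ∀ n i → bin (2 ℕ.* suc n) i ≈ bin (2 ℕ.* n) i + (1# + 1#) * bin (2 ℕ.* n) (down i) + bin (2 ℕ.* n) (down (down i))
  bin-pascal² n i = begin
    bin (2 ℕ.* suc n) i
      ≡⟨ ≡.cong (λ N → bin N i) (ℕ.*-suc 2 n) ⟩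
    bin (suc (suc N)) i
      ≈⟨ trans (bin-pascal (suc N) i) (+-cong (bin-pascal N (down i)) (bin-pascal N i)) ⟩
    bin N (down (down i)) + bin N (down i) + (bin N (down i) + bin N i)
      ≈⟨ solve 3 (λ a b d → a :+ b :+ (b :+ d) := d :+ con (+ 2) :* b :+ a) refl _ _ _ ⟩
    bin N i + (1# + 1#) * bin N (down i) + bin N (down (down i)) ∎
    where
    N = 2 ℕ.* n

  -- Kept in the literal form of `rhs`; `slope` is the variant suited to shifts.
  ballot : ℕ → ℕ → Carrier
  ballot n k = bin (2 ℕ.* n) (+ n ℤ.- + k) - bin (2 ℕ.* n) ((+ n ℤ.- + k) ℤ.- + 1)

  slope : ℕ → ℤ → Carrier
  slope n i = bin (2 ℕ.* n) i - bin (2 ℕ.* n) (down i)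

  ballot≈slope : ∀ n k {i} → n ⊖ k ≡ i → ballot n k ≈ slope n i
  ballot≈slope n k ≡.refl = reflexive (≡.trans
    (≡.cong (λ j → bin (2 ℕ.* n) (+ n ℤ.- + k) - bin (2 ℕ.* n) j) (i-1≡down (+ n ℤ.- + k)))
    (≡.cong (slope n) (ℤ.[+m]-[+n]≡m⊖n n k)))

  -- Multiplication by t in the basis χ_k = Σ_{|i| ≤ k} vⁱ: t χ_k = χ_{k+1} + 2 χ_k + χ_{k-1} for k
  -- ≥ 1, but t χ_0 = χ_1 + χ_0.
  Δ₊ : (ℕ → Carrier) → ℕ → Carrier
  Δ₊ α zero = α 1 + α 0
  Δ₊ α (suc k) = α (suc (suc k)) + (1# + 1#) * α (suc k) + α k

  ballot-suc : ∀ n k → ballot (suc n) k ≈ Δ₊ (ballot n) k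
  ballot-suc n zero = begin
    ballot (suc n) 0
      ≈⟨ ballot≈slope (suc n) 0 ≡.refl ⟩
    bin (2 ℕ.* suc n) (up (+ n)) - bin (2 ℕ.* suc n) (+ n)
      ≈⟨ +-cong (bin-pascal² n (up (+ n))) (-‿cong (bin-pascal² n (+ n))) ⟩
    (β (up (+ n)) + (1# + 1#) * β (+ n) + β (down (+ n))) - (β (+ n) + (1# + 1#) * β (down (+ n)) + β (down (down (+ n))))
      -- Two Pascal steps give slopes at n + 1, n, n - 1 with weights 1, 2, 1; by central symmetry
      -- the first cancels one copy of the second.
      ≈⟨ certify (1# · reflexive (≡.cong fromℕ (binZ-central-sym n)))
        (solve 4 (λ a b d e → (a :+ con (+ 2) :* b :+ d) :- (b :+ con (+ 2) :* d :+ e)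
          := (d :- e) :+ (b :- d) :+ con (+ 1) :* (a :- d)) refl _ _ _ _) ⟩
    slope n (down (+ n)) + slope n (+ n)
      ≈⟨ +-cong (ballot≈slope n 1 (⊖-suc n 0)) (ballot≈slope n 0 ≡.refl) ⟨
    ballot n 1 + ballot n 0 ∎
    where
    β : ℤ → Carrier
    β = bin (2 ℕ.* n)
  ballot-suc n (suc k) = begin
    ballot (suc n) (suc k)
      ≈⟨ ballot≈slope (suc n) (suc k) (ℤ.[1+m]⊖[1+n]≡m⊖n n k) ⟩
    bin (2 ℕ.* suc n) i - bin (2 ℕ.* suc n) (down i)
      ≈⟨ +-cong (bin-pascal² n i) (-‿cong (bin-pascal² n (down i))) ⟩
    _ ≈⟨ solve 4 (λ a b d e → (a :+ con (+ 2) :* b :+ d) :- (b :+ con (+ 2) :* d :+ e)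
          := (d :- e) :+ con (+ 2) :* (b :- d) :+ (a :- b)) refl _ _ _ _ ⟩
    slope n (down (down i)) + (1# + 1#) * slope n (down i) + slope n i
      ≈⟨ +-cong (+-cong (ballot≈slope n (suc (suc k)) (≡.trans (⊖-suc n (suc k)) (≡.cong down (⊖-suc n k))))
                        (*-congˡ (ballot≈slope n (suc k) (⊖-suc n k))))
                (ballot≈slope n k ≡.refl) ⟨
    Δ₊ (ballot n) (suc k) ∎
    where
    i = n ⊖ k

  ballot-vanish : ∀ n k → n < k → ballot n k ≈ 0#
  ballot-vanish n k n<k with ⊖-negative n k n<k
  ... | m , eq = trans (ballot≈slope n k eq) (-‿inverseʳ 0#)

  -- Summation by parts: the matrix of `Δ₊` is symmetric, so only the cut at m contributes, as a
  -- discrete Wronskian.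
  Δ₊-selfAdjoint : ∀ (α γ : ℕ → Carrier) m →
    sumUpTo m (λ k → α k * Δ₊ γ k) ≈ sumUpTo m (λ k → Δ₊ α k * γ k) + (α m * γ (suc m) - α (suc m) * γ m)
  Δ₊-selfAdjoint α γ zero =
    solve 4 (λ a a₁ g g₁ → a :* (g₁ :+ g) := (a₁ :+ a) :* g :+ (a :* g₁ :- a₁ :* g)) refl _ _ _ _
  Δ₊-selfAdjoint α γ (suc m) = trans (+-congʳ (Δ₊-selfAdjoint α γ m))
    (solve 7 (λ s a a₁ a₂ g g₁ g₂ →
      s :+ (a :* g₁ :- a₁ :* g) :+ a₁ :* (g₂ :+ con (+ 2) :* g₁ :+ g)
      := s :+ (a₂ :+ con (+ 2) :* a₁ :+ a) :* g₁ :+ (a₁ :* g₂ :- a₂ :* g₁)) refl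
      _ (α m) (α (suc m)) (α (suc (suc m))) (γ m) (γ (suc m)) (γ (suc (suc m))))

  fold : (ℤ → Carrier) → ℕ → Carrier
  fold f k = f (+ k) - f -[1+ k ]

  fold-Δ : ∀ f k → fold (Δ f) k ≈ Δ₊ (fold f) k
  fold-Δ f zero = solve 4 (λ a b d e →
    (a :+ con (+ 2) :* b :+ d) :- (b :+ con (+ 2) :* d :+ e) := (a :- e) :+ (b :- d)) refl _ _ _ _
  fold-Δ f (suc k) = solve 6 (λ a b d a' b' d' →
    (a :+ con (+ 2) :* b :+ d) :- (d' :+ con (+ 2) :* b' :+ a')
    := (a :- a') :+ con (+ 2) :* (b :- b') :+ (d :- d')) refl _ _ _ _ _ _

  ev≈ballotSum : ∀ n f → ev n f ≈ sumUpTo n (λ k → ballot n k * fold f k)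
  ev≈ballotSum zero f = solve 2 (λ a b → a :- b := (con (+ 1) :+ con (+ 0) :- con (+ 0)) :* (a :- b)) refl _ _
  ev≈ballotSum (suc n) f = begin
    ev n (Δ f)
      ≈⟨ ev≈ballotSum n (Δ f) ⟩
    sumUpTo n (λ k → ballot n k * fold (Δ f) k)
      ≈⟨ sum-cong n (λ k _ → *-congˡ (fold-Δ f k)) ⟩
    sumUpTo n (λ k → ballot n k * Δ₊ (fold f) k)
      -- The sum is extended to n + 1, where the ballot number is zero; the boundary terms at that
      -- cut then vanish too.
      ≈⟨ trans (+-congˡ (trans (*-congʳ vanish₁) (zeroˡ _))) (+-identityʳ _) ⟨
    sumUpTo (suc n) (λ k → ballot n k * Δ₊ (fold f) k)
      ≈⟨ Δ₊-selfAdjoint (ballot n) (fold f) (suc n) ⟩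
    sumUpTo (suc n) (λ k → Δ₊ (ballot n) k * fold f k)
      + (ballot n (suc n) * fold f (suc (suc n)) - ballot n (suc (suc n)) * fold f (suc n))
      ≈⟨ certify (fold f (suc (suc n)) · vanish₁ ⊞ (- fold f (suc n)) · vanish₂)
          (solve 5 (λ s a b x y → s :+ (a :* x :- b :* y)
             := s :+ (x :* (a :- con (+ 0)) :+ (:- y) :* (b :- con (+ 0)))) refl _ _ _ _ _) ⟩
    sumUpTo (suc n) (λ k → Δ₊ (ballot n) k * fold f k)
      ≈⟨ sum-cong (suc n) (λ k _ → *-congʳ (ballot-suc n k)) ⟨
    sumUpTo (suc n) (λ k → ballot (suc n) k * fold f k) ∎
    where
    vanish₁ : ballot n (suc n) ≈ 0#
    vanish₁ = ballot-vanish n (suc n) ℕ.≤-refl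
    vanish₂ : ballot n (suc (suc n)) ≈ 0#
    vanish₂ = ballot-vanish n (suc (suc n)) (ℕ.m≤n⇒m≤1+n ℕ.≤-refl)

-- Specialisation to q and y, and the final comparison.

module Main {c ℓ : Level} (R : CommutativeRing c ℓ) where
  open CommutativeRing R hiding (zero)
  open CF R
  open IntegerSolver R
  open Certificates R
  open Series R
  open Bilateral R
  open Ballot R
  open Relation.Binary.Reasoning.Setoid setoid

  pow-+ : ∀ x m n → pow x (m ℕ.+ n) ≈ pow x m * pow x n
  pow-+ x zero n = sym (*-identityˡ _)
  pow-+ x (suc m) n = trans (*-congˡ (pow-+ x m n)) (sym (*-assoc _ _ _))

  pow-* : ∀ x y n → pow (x * y) n ≈ pow x n * pow y n
  pow-* x y zero = sym (*-identityˡ _)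
  pow-* x y (suc n) = trans (*-congˡ (pow-* x y n))
    (solve 4 (λ x y a b → (x :* y) :* (a :* b) := (x :* a) :* (y :* b)) refl _ _ _ _)

  pow-square : ∀ x n → pow (x * x) n ≈ pow x (2 ℕ.* n)
  pow-square x n = trans (pow-* x x n)
    (trans (sym (pow-+ x n n)) (reflexive (≡.cong (λ m → pow x (n ℕ.+ m)) (≡.sym (ℕ.+-identityʳ n)))))

  pow-twice : ∀ x n → pow x (twice n) ≈ pow (x * x) n
  pow-twice x zero = refl
  pow-twice x (suc n) = trans (*-congˡ (*-congˡ (pow-twice x n))) (sym (*-assoc _ _ _))

  window : (ℤ → Carrier) → ℕ → Carrier
  window g k = sumUpTo (2 ℕ.* k) (λ j → g (+ j ℤ.- + k))

  window-suc : ∀ g k → window g (suc k) ≈ g -[1+ k ] + window g k + g (+ suc k)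
  window-suc g k = begin
    sumUpTo (2 ℕ.* suc k) F
      ≡⟨ ≡.cong (λ m → sumUpTo m F) (ℕ.*-suc 2 k) ⟩
    sumUpTo (suc (2 ℕ.* k)) F + F (suc (suc (2 ℕ.* k)))
      ≈⟨ +-cong (sum-head (2 ℕ.* k) F) (reflexive (≡.cong g last)) ⟩
    g -[1+ k ] + sumUpTo (2 ℕ.* k) (F ∘ suc) + g (+ suc k)
      ≈⟨ +-congʳ (+-congˡ (sum-cong (2 ℕ.* k) (λ j _ → reflexive (≡.cong g (shift j))))) ⟩
    g -[1+ k ] + window g k + g (+ suc k) ∎
    where
    F : ℕ → Carrier
    F j = g (+ j ℤ.- + suc k)
    shift : ∀ j → + suc j ℤ.- + suc k ≡ + j ℤ.- + k
    shift j = ≡.trans (ℤ.[1+m]⊖[1+n]≡m⊖n j k) (≡.sym (ℤ.[+m]-[+n]≡m⊖n j k))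
    last : + suc (suc (2 ℕ.* k)) ℤ.- + suc k ≡ + suc k
    last = ≡.trans (≡.cong (_⊖ suc k) (≡.trans (≡.sym (ℕ.*-suc 2 k)) (≡.cong (suc k ℕ.+_) (ℕ.+-identityʳ (suc k)))))
      (m+n⊖n (suc k) (suc k))

  module _ (y y' q q' : Carrier) (yy' : y * y' ≈ 1#) (qq' : q * q' ≈ 1#) where

    -- With x = q y one gets σ = q (y + y⁻¹), so `ϑ` factors as (1 + y q X)(1 + y⁻¹ q X).
    p p' x x' : Carrier
    p = q * q
    p' = q' * q'
    x = q * y
    x' = q' * y'

    pp' : p * p' ≈ 1#
    pp' = certify ((q * q') · qq' ⊞ 1# · qq')
      (solve 2 (λ a b → a :* a :* (b :* b) := con (+ 1) :+ (a :* b :* (a :* b :- con (+ 1)) :+ con (+ 1) :* (a :* b :- con (+ 1)))) refl q q')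

    xx' : x * x' ≈ 1#
    xx' = certify ((y * y') · qq' ⊞ 1# · yy')
      (solve 4 (λ a a' b b' → a :* b :* (a' :* b') := con (+ 1) :+ (b :* b' :* (a :* a' :- con (+ 1)) :+ con (+ 1) :* (b :* b' :- con (+ 1)))) refl q q' y y')

    open Moments p p' x x' pp' xx' using (b; ϑ; ev-b≈tower)

    theta : ℤ → Carrier
    theta i = zpow y y' i * zpow q q' (ℤ.- (i ℤ.* i))

    fold-b : ∀ k → fold b k ≈ pow q (k ℕ.* (k ℕ.+ 1)) * window theta k
    fold-b zero = solve 0 (con (+ 1) :- con (+ 0) := con (+ 1) :* (con (+ 1) :* con (+ 1))) refl
    fold-b (suc k) = begin
      (pow p K * b₊ + pow x K) - pow p K * (b₋ - pow x' K)
        ≈⟨ +-cong (+-cong (*-congʳ (pow-* q q K)) (pow-* q y K)) (-‿cong (*-cong (pow-* q q K) (+-congˡ (-‿cong (pow-* q' y' K))))) ⟩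
      (Q * Q * b₊ + Q * Y) - Q * Q * (b₋ - Q' * Y')
        ≈⟨ certify ((Q * Q) · fold-b k ⊞ (Q * Y') · pow-inverse qq' K ⊞ (- (Q * (Y + Y'))) · pow-inverse qq' (K ℕ.* K))
            (solve 10 (λ Q Q' Y Y' b₊ b₋ T s S S' →
              (Q :* Q :* b₊ :+ Q :* Y) :- Q :* Q :* (b₋ :- Q' :* Y')
              := (Q :* Q :* T :* s :+ Q :* S :* (Y' :* S') :+ Q :* S :* (Y :* S'))
                 :+ (Q :* Q :* (b₊ :- b₋ :- T :* s) :+ (Q :* Y') :* (Q :* Q' :- con (+ 1)) :+ (:- (Q :* (Y :+ Y'))) :* (S :* S' :- con (+ 1))))
              refl Q Q' Y Y' b₊ b₋ T s S S') ⟩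
      Q * Q * T * s + Q * S * (Y' * S') + Q * S * (Y * S')
        ≈⟨ +-cong (+-cong (*-congʳ exp₁) (*-congʳ exp₂)) (*-congʳ exp₂) ⟨
      E * s + E * (Y' * S') + E * (Y * S')
        ≈⟨ solve 4 (λ e s a d → e :* s :+ e :* a :+ e :* d := e :* (a :+ s :+ d)) refl _ _ _ _ ⟩
      E * (theta -[1+ k ] + s + theta (+ K))
        ≈⟨ *-congˡ (window-suc theta k) ⟨
      E * window theta K ∎
      where
      K = suc k
      b₊ = b (+ k)
      b₋ = b -[1+ k ]
      Q = pow q K
      Q' = pow q' K
      Y = pow y K
      Y' = pow y' K
      S = pow q (K ℕ.* K)
      S' = pow q' (K ℕ.* K)
      T = pow q (k ℕ.* (k ℕ.+ 1))
      s = window theta k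
      E = pow q (K ℕ.* (K ℕ.+ 1))
      exp₁ : E ≈ Q * Q * T
      exp₁ = trans (reflexive (≡.cong (pow q) (+-*-Solver.solve 1 (λ k → let one = +-*-Solver.con 1; _⊕_ = +-*-Solver._:+_; _⊗_ = +-*-Solver._:*_ in
          ((one ⊕ k) ⊗ ((one ⊕ k) ⊕ one)) +-*-Solver.:= (((one ⊕ k) ⊕ (one ⊕ k)) ⊕ (k ⊗ (k ⊕ one)))) ≡.refl k)))
        (trans (pow-+ q (K ℕ.+ K) _) (*-congʳ (pow-+ q K K)))
      exp₂ : E ≈ Q * S
      exp₂ = trans (reflexive (≡.cong (pow q) (≡.trans (ℕ.*-distribˡ-+ K K 1) (≡.trans (ℕ.+-comm (K ℕ.* K) _) (≡.cong (ℕ._+ K ℕ.* K) (ℕ.*-identityʳ K))))))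
        (pow-+ q K (K ℕ.* K))

    -- Setting w = 1 strips the common factor w² from every λ; `tower-homogeneous` restores it.
    lam : ℕ → Carrier
    lam = lamCF y y' q 1#

    lamCF≈lam : ∀ w m → lamCF y y' q w m ≈ lam m * (w * w)
    lamCF≈lam w m with odd m
    ... | true = solve 2 (λ a w → a :* (w :* w) := a :* (con (+ 1) :* con (+ 1)) :* (w :* w)) refl _ w
    ... | false = solve 2 (λ a w → a :* w :* (a :* w) := a :* con (+ 1) :* (a :* con (+ 1)) :* (w :* w)) refl _ w

    odd-twice : ∀ h → odd (twice h) ≡ false
    odd-twice zero = ≡.refl
    odd-twice (suc h) rewrite odd-twice h = ≡.refl

    lam-even : ∀ h → lam (twice h) ≈ (1# - pow p h) * (1# - pow p h)
    lam-even h rewrite odd-twice h = *-cong eq eq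
      where
      eq : (1# - pow q (twice h)) * 1# ≈ 1# - pow p h
      eq = trans (*-identityʳ _) (+-congˡ (-‿cong (pow-twice q h)))

    lam-odd : ∀ h → lam (suc (twice h)) ≈ ϑ (pow p h)
    lam-odd h rewrite odd-twice h =
      certify ((q * y + q * y' + y * y' * (q * q) * (pow q (twice h) + pow p h)) · pow-twice q h
               ⊞ (- (pow p h * q * y')) · qq' ⊞ (pow p h * pow p h * (q * q)) · yy')
        (solve 6 (λ q q' y y' P H →
          (con (+ 1) :+ y :* (q :* P)) :* (con (+ 1) :+ y' :* (q :* P)) :* (con (+ 1) :* con (+ 1))
          := (con (+ 1) :+ H :* (q :* y :+ q :* q :* (q' :* y')) :+ q :* q :* (H :* H))
             :+ ((q :* y :+ q :* y' :+ y :* y' :* (q :* q) :* (P :+ H)) :* (P :- H)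
                 :+ (:- (H :* q :* y')) :* (q :* q' :- con (+ 1)) :+ (H :* H :* (q :* q)) :* (y :* y' :- con (+ 1))))
          refl q q' y y' (pow q (twice h)) (pow p h))

    tower≈rhs : ∀ w n → tower (lamCF y y' q w) 1 n ≈ rhs y y' q q' w n
    tower≈rhs w n = begin
      tower (lamCF y y' q w) 1 n
        ≈⟨ tower-cong _ _ (λ m → lamCF≈lam w (suc m)) 1 n ⟩
      tower (λ m → lam m * (w * w)) 1 n
        ≈⟨ tower-homogeneous lam (w * w) 1 n ⟩
      pow (w * w) n * tower lam 1 n
        ≈⟨ *-cong (pow-square w n) (sym (ev-b≈tower lam lam-even lam-odd n)) ⟩
      pow w (2 ℕ.* n) * ev n b
        ≈⟨ *-congˡ (ev≈ballotSum n b) ⟩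
      pow w (2 ℕ.* n) * sumUpTo n (λ k → ballot n k * fold b k)
        ≈⟨ *-congˡ (sum-cong n (λ k _ → trans (*-congˡ (fold-b k)) (sym (*-assoc _ _ _)))) ⟩
      rhs y y' q q' w n ∎

theorem0p1 : {c ℓ : Level} (R : CommutativeRing c ℓ) →
    let open CommutativeRing R in let open CF R in
    (y y' q q' w : Carrier) →
    y * y' ≈ 1# → q * q' ≈ 1# → (1# - q) * w ≈ 1# →
    (n : ℕ) → ∃ λ N → (d : ℕ) → N ≤ d →
    cf (lamCF y y' q w) d 1 n ≈ rhs y y' q q' w n
-- Truncation at depth n already fixes the coefficient of zⁿ, so N = n.
theorem0p1 R y y' q q' w yy' qq' _ n = n , λ d n≤d →
  trans (cf≈tower (lamCF y y' q w) d n n≤d) (tower≈rhs y y' q q' yy' qq' w n)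
  where
  open CommutativeRing R using (trans)
  open CF R using (lamCF)
  open Series R using (cf≈tower)
  open Main R using (tower≈rhs)
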